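{- Let $G$ be a finite connected simple graph with at least one edge. Then $G$ is walk-regular if and only if for every $n\in\mathbb{N}$ and all $x,y\in V(G)$ one has $\Pr_x(Z(n)=x)=\Pr_y(Z(n)=y)$.
   Context: Graphs are undirected. A graph $G$ is called walk-regular if, for every $n\in\mathbb{N}$, the number of closed walks in $G$ of length $n$ starting (and ending) at a vertex $x$ is independent of the choice of $x\in V(G)$. Here $(Z(n))_{n\ge 0}$ denotes simple random walk on $G$ (at each step the walk moves to a neighbour of the current vertex chosen uniformly at random), and $\Pr_x(Z(n)=x)$ denotes the probability that simple random walk started at $x$ is at its starting vertex $x$ after $n$ steps. -}

module Defs where

open import Data.Fin.Base using (Fin)
open import Data.Fin.Properties using (_≟_)
open import Data.Integer.Base using (1ℤ)
open import Data.List.Base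
  using (List; [_]; map; foldr; filter; length; allFin; cartesianProductWith)
open import Data.List.Membership.Propositional.Properties using (∈-allFin; ∈-filter⁺; ∈-length)
open import Data.Nat.Base using (ℕ; zero; suc; NonZero; >-nonZero)
open import Data.Product.Base using (_×_; ∃₂)
open import Data.Rational.Base using (ℚ; 0ℚ; 1ℚ; _+_; _*_; _/_)
open import Data.Vec.Base using (Vec; []; _∷_; head; last)
open import Data.Vec.Relation.Unary.Linked using (Linked; linked?)
open import Level using (0ℓ)
open import Relation.Binary.Construct.Closure.ReflexiveTransitive using (Star)
open import Relation.Binary.Core using (Rel)
import Relation.Binary.Definitions as B
open import Relation.Binary.PropositionalEquality.Core using (_≡_)
open import Relation.Nullary using (¬_; yes; no; _×-dec_)
import Relation.Unary as U

record FiniteSimpleGraph : Set₁ where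
  field
    order      : ℕ
    Adj        : Rel (Fin order) 0ℓ
    adj?       : B.Decidable Adj
    adj-sym    : B.Symmetric Adj
    adj-irrefl : ∀ {x} → ¬ Adj x x

  V : Set
  V = Fin order

-- Each vector of vertices of the given length occurs exactly once.
sequences : (m k : ℕ) → List (Vec (Fin m) k)
sequences m zero    = [ [] ]
sequences m (suc k) = cartesianProductWith _∷_ (allFin m) (sequences m k)

sumℚ : List ℚ → ℚ
sumℚ = foldr _+_ 0ℚ

module _ (G : FiniteSimpleGraph) where
  open FiniteSimpleGraph G

  Connected : Set
  Connected = ∀ x y → Star Adj x y

  HasEdge : Set
  HasEdge = ∃₂ λ x y → Adj x y

  -- A walk of length n is a sequence of n + 1 vertices, consecutive ones adjacent.
  IsClosedWalkAt : V → {n : ℕ} → Vec V (suc n) → Set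
  IsClosedWalkAt x v = Linked Adj v × head v ≡ x × last v ≡ x

  isClosedWalkAt? : ∀ x {n} → U.Decidable (IsClosedWalkAt x {n})
  isClosedWalkAt? x v = linked? adj? v ×-dec (head v ≟ x) ×-dec (last v ≟ x)

  #closedWalks : ℕ → V → ℕ
  #closedWalks n x = length (filter (isClosedWalkAt? x) (sequences order (suc n)))

  WalkRegular : Set
  WalkRegular = ∀ n x y → #closedWalks n x ≡ #closedWalks n y

  degree : V → ℕ
  degree x = length (filter (adj? x) (allFin order))

  degree-nonZero : ∀ {x y} → Adj x y → NonZero (degree x)
  degree-nonZero {x} {y} x~y = >-nonZero (∈-length (∈-filter⁺ (adj? x) (∈-allFin y) x~y))

  -- At an isolated vertex all of these are 0 (the walk is undefined there);
  -- a connected graph with an edge has no such vertex.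
  transitionProb : V → V → ℚ
  transitionProb x y with adj? x y
  ... | yes x~y = _/_ 1ℤ (degree x) {{degree-nonZero x~y}}
  ... | no  _   = 0ℚ

  transitionProduct : ∀ {n} → Vec V (suc n) → ℚ
  transitionProduct (v ∷ [])     = 1ℚ
  transitionProduct (v ∷ w ∷ vs) = transitionProb v w * transitionProduct (w ∷ vs)

  -- The probability that (Z 0 , … , Z n) equals the given sequence, started at x.
  trajectoryProb : V → ∀ {n} → Vec V (suc n) → ℚ
  trajectoryProb x v with head v ≟ x
  ... | yes _ = transitionProduct v
  ... | no  _ = 0ℚ

  -- The probability of an event depending on Z 0 , … , Z n only, started at x.
  Pr : V → ∀ {n} {P : U.Pred (Vec V (suc n)) 0ℓ} → U.Decidable P → ℚ
  Pr x {n} P? = sumℚ (map (trajectoryProb x) (filter P? (sequences order (suc n))))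

  -- Pr_x (Z n = x)
  returnProb : ℕ → V → ℚ
  returnProb n x = Pr x {n} (λ v → last v ≟ x)

{-# OPTIONS --safe #-}

-- Both properties force G to be regular, and on a d-regular graph the number of closed
-- walks of length n at x is dⁿ times the return probability. Walk-regularity gives
-- regularity through walks of length 2. For constant return probabilities, let P be the
-- transition matrix and Δ = I - P. By the maximum principle ker Δ consists of the
-- constants, and since the degree vector π is stationary, π Δ = 0, so that
-- ker Δ² = ker Δ. A linear relation between the powers of Δ therefore yields a polynomial q
-- with q(0) ≠ 0 and Δ q(Δ) = 0. The columns of q(Δ) are constant, hence equal to the
-- diagonal entry, which does not depend on the vertex because the diagonals of all powers
-- of P are constant. Pairing column y with π gives (∑ π) q(Δ)(y,y) = q(0) π(y), so π is
-- constant.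
module Submission where

open import Defs
open import Algebra.Bundles using (CommutativeRing)
open import Data.Fin.Base using (Fin; zero; suc; toℕ; punchIn; combine; remQuot)
open import Data.Fin.Properties using (_≟_; all?; ¬∀⟶∃¬; remQuot-combine; punchInᵢ≢i)
open import Data.Integer.Base as ℤ using (1ℤ)
import Data.Integer.Properties as ℤ
open import Data.List.Base as List using (List; []; _∷_; allFin; filter)
import Data.List.Extrema
open import Data.List.Membership.Propositional.Properties using (∈-allFin)
open import Data.List.Properties using (map-++; map-∘; map-tabulate)
import Data.List.Relation.Unary.All as All
open import Data.Maybe.Base using (just; nothing)
open import Data.Nat.Base as ℕ using (ℕ; zero; suc)
open import Data.Product.Base using (∃; _×_; _,_; proj₁; proj₂; uncurry)
open import Data.Rational.Base
  using (ℚ; 0ℚ; 1ℚ; _+_; _*_; _-_; -_; 1/_; _/_; _≤_; NonZero; ≢-nonZero; nonNegative; toℚᵘ)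
import Data.Rational.Properties as ℚ
open import Data.Rational.Unnormalised.Base as ℚᵘ using (mkℚᵘ; *≡*)
import Data.Rational.Unnormalised.Properties as ℚᵘ
open import Data.Vec.Base as Vec using (Vec; []; _∷_)
open import Data.Vec.Functional using (Vector; head; tail; removeAt; insertAt)
open import Data.Vec.Functional.Properties using (insertAt-lookup; insertAt-punchIn)
open import Data.Vec.Relation.Unary.Linked as Linked using (linked?; _∷_)
open import Function.Base using (_∘_; case_of_; id)
open import Function.Bundles using (_⇔_; mk⇔)
open import Relation.Binary.Bundles using (DecTotalOrder)
open import Relation.Binary.Construct.Closure.ReflexiveTransitive using (Star; ε; _◅_)
open import Relation.Binary.PropositionalEquality
  using (_≡_; _≢_; refl; sym; trans; cong; cong₂; subst; module ≡-Reasoning)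
open import Relation.Nullary using (Dec; yes; no; ¬_; contradiction; _×-dec_)
import Relation.Unary as U
open import Tactic.RingSolver using (solve-∀)
open import Tactic.RingSolver.Core.AlmostCommutativeRing
  using (AlmostCommutativeRing; fromCommutativeRing)
open import Algebra.Properties.Semiring.Sum
  (CommutativeRing.semiring ℚ.+-*-commutativeRing)
open FiniteSimpleGraph using (V)

private
  variable
    m n N : ℕ
    A B : Set

-- Rational arithmetic and finite sums.

ℚ-ring : AlmostCommutativeRing _ _
ℚ-ring = fromCommutativeRing ℚ.+-*-commutativeRing
  λ x → case 0ℚ ℚ.≟ x of λ { (yes p) → just p ; (no _) → nothing }

*-cancelˡ : ∀ {p q r : ℚ} → p ≢ 0ℚ → p * q ≡ p * r → q ≡ r
*-cancelˡ {p} {q} {r} p≢0 pq≡pr = begin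
  q              ≡⟨ lemma q ⟨
  1/ p * (p * q) ≡⟨ cong (1/ p *_) pq≡pr ⟩
  1/ p * (p * r) ≡⟨ lemma r ⟩
  r              ∎
  where
  open ≡-Reasoning
  instance
    p-nonZero : NonZero p
    p-nonZero = ≢-nonZero p≢0
  lemma : ∀ s → 1/ p * (p * s) ≡ s
  lemma s = trans (sym (ℚ.*-assoc (1/ p) p s))
    (trans (cong (_* s) (ℚ.*-inverseˡ p)) (ℚ.*-identityˡ s))

*-cancel-0 : ∀ {p q : ℚ} → p ≢ 0ℚ → p * q ≡ 0ℚ → q ≡ 0ℚ
*-cancel-0 {p} p≢0 pq≡0 = *-cancelˡ p≢0 (trans pq≡0 (sym (ℚ.*-zeroʳ p)))

x-y≡0⇒x≡y : ∀ {x y : ℚ} → x - y ≡ 0ℚ → x ≡ y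
x-y≡0⇒x≡y {x} {y} eq = trans (lemma x y) (trans (cong (_+ y) eq) (ℚ.+-identityˡ y))
  where
  lemma : ∀ x y → x ≡ x - y + y
  lemma = solve-∀ ℚ-ring

sum-zero : ∀ {n} {f : Vector ℚ n} → (∀ i → f i ≡ 0ℚ) → sum f ≡ 0ℚ
sum-zero {n} f≡0 = trans (sum-cong-≗ f≡0) (sum-replicate-zero n)

sum-sub : ∀ {n} (f g : Vector ℚ n) → ∑[ i < n ] (f i - g i) ≡ sum f - sum g
sum-sub {zero}  f g = refl
sum-sub {suc n} f g = trans (cong (f zero - g zero +_) (sum-sub (tail f) (tail g)))
  (lemma (f zero) (g zero) (sum (tail f)) (sum (tail g)))
  where
  lemma : ∀ a b c d → a - b + (c - d) ≡ (a + c) - (b + d)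
  lemma = solve-∀ ℚ-ring

sum-nonNeg : ∀ {n} {f : Vector ℚ n} → (∀ i → 0ℚ ≤ f i) → 0ℚ ≤ sum f
sum-nonNeg {zero}  f≥0 = ℚ.≤-refl
sum-nonNeg {suc n} f≥0 = ℚ.+-mono-≤ (f≥0 zero) (sum-nonNeg (f≥0 ∘ suc))

-- Splitting off the `i`-th term leaves a nonnegative remainder, so each term is at most the whole
-- sum.
sum-nonNeg-≡0 : ∀ {n} {f : Vector ℚ n} → (∀ i → 0ℚ ≤ f i) → sum f ≡ 0ℚ → ∀ i → f i ≡ 0ℚ
sum-nonNeg-≡0 {suc n} {f} f≥0 ∑f≡0 i = ℚ.≤-antisym fi≤0 (f≥0 i)
  where
  open ℚ.≤-Reasoning
  fi≤0 : f i ≤ 0ℚ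
  fi≤0 = begin
    f i                        ≡⟨ ℚ.+-identityʳ (f i) ⟨
    f i + 0ℚ                   ≤⟨ ℚ.+-monoʳ-≤ (f i) (sum-nonNeg (f≥0 ∘ punchIn i)) ⟩
    f i + sum (removeAt f i)   ≡⟨ sum-remove f ⟨
    sum f                      ≡⟨ ∑f≡0 ⟩
    0ℚ                         ∎

-- Linear dependence

-- Gaussian elimination by induction on the dimension. If coordinate `zero` vanishes on all vectors,
-- it is dropped and the first vector gets coefficient 0. Otherwise a pivot clears that coordinate
-- from the other vectors, and a dependency among the reduced vectors lifts back.
dependent : ∀ m (v : Fin (suc m) → Vector ℚ m) →
  ∃ λ (a : Vector ℚ (suc m)) → (∃ λ i → a i ≢ 0ℚ) × (∀ j → ∑[ i < suc m ] (a i * v i j) ≡ 0ℚ)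
dependent zero    v = (λ _ → 1ℚ) , (zero , ℚ.1≢0) , λ ()
dependent (suc m) v with all? (λ i → v i zero ℚ.≟ 0ℚ)
... | yes v₀≡0 = a′ , (suc i , bi≢0) , eq
  where
  rest = dependent m (λ i → tail (v (suc i)))
  b = proj₁ rest
  i = proj₁ (proj₁ (proj₂ rest))
  bi≢0 = proj₂ (proj₁ (proj₂ rest))
  a′ : Vector ℚ (suc (suc m))
  a′ zero    = 0ℚ
  a′ (suc i) = b i
  eq : ∀ j → ∑[ i < suc (suc m) ] (a′ i * v i j) ≡ 0ℚ
  eq zero    = sum-zero λ i → trans (cong (a′ i *_) (v₀≡0 i)) (ℚ.*-zeroʳ (a′ i))
  eq (suc j) = cong₂ _+_ (ℚ.*-zeroˡ (v zero (suc j))) (proj₂ (proj₂ rest) j)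
... | no ¬v₀≡0 = a′ , (punchIn p i , a′i≢0) , eq
  where
  open ≡-Reasoning
  pivot = ¬∀⟶∃¬ _ _ (λ i → v i zero ℚ.≟ 0ℚ) ¬v₀≡0
  p = proj₁ pivot
  c = v p zero
  u : Fin (suc m) → Vector ℚ (suc m)
  u = v ∘ punchIn p
  -- Elimination without division: `u i` is scaled by the pivot entry `c` before the multiple of
  -- `v p` is subtracted.
  rest = dependent m (λ i j → c * u i (suc j) - u i zero * v p (suc j))
  b = proj₁ rest
  i = proj₁ (proj₁ (proj₂ rest))
  s = ∑[ k < suc m ] (b k * u k zero)
  -- Undoing the elimination: the coefficient of the pivot vector collects all the multiples of
  -- `v p` that were subtracted, weighted by `b`.
  a′ : Vector ℚ (suc (suc m))
  a′ = insertAt (λ k → c * b k) p (- s)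
  a′-p : a′ p ≡ - s
  a′-p = insertAt-lookup (λ k → c * b k) p (- s)
  a′-u : ∀ k → a′ (punchIn p k) ≡ c * b k
  a′-u k = insertAt-punchIn (λ k → c * b k) p (- s) k
  a′i≢0 : a′ (punchIn p i) ≢ 0ℚ
  a′i≢0 eq = proj₂ (proj₁ (proj₂ rest))
    (*-cancel-0 (proj₂ pivot) (trans (sym (a′-u i)) eq))
  expand : ∀ j → ∑[ i < suc (suc m) ] (a′ i * v i j)
               ≡ ∑[ k < suc m ] (b k * (c * u k j - u k zero * v p j))
  expand j = begin
    ∑[ i < suc (suc m) ] (a′ i * v i j)
      ≡⟨ sum-remove {i = p} (λ i → a′ i * v i j) ⟩
    a′ p * v p j + ∑[ k < suc m ] (a′ (punchIn p k) * u k j)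
      ≡⟨ cong₂ _+_ (cong (_* v p j) a′-p) (sum-cong-≗ λ k → cong (_* u k j) (a′-u k)) ⟩
    - s * v p j + ∑[ k < suc m ] (c * b k * u k j)
      ≡⟨ lemma₁ s (v p j) _ ⟩
    ∑[ k < suc m ] (c * b k * u k j) - s * v p j
      ≡⟨ cong (λ t → ∑[ k < suc m ] (c * b k * u k j) - t) (*-distribʳ-sum (v p j) (λ k → b k * u k zero)) ⟩
    ∑[ k < suc m ] (c * b k * u k j) - ∑[ k < suc m ] (b k * u k zero * v p j)
      ≡⟨ sum-sub (λ k → c * b k * u k j) (λ k → b k * u k zero * v p j) ⟨
    ∑[ k < suc m ] (c * b k * u k j - b k * u k zero * v p j)
      ≡⟨ sum-cong-≗ (λ k → lemma₂ c (b k) (u k j) (u k zero) (v p j)) ⟩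
    ∑[ k < suc m ] (b k * (c * u k j - u k zero * v p j)) ∎
    where
    lemma₁ : ∀ s x t → - s * x + t ≡ t - s * x
    lemma₁ = solve-∀ ℚ-ring
    lemma₂ : ∀ c b x y z → c * b * x - b * y * z ≡ b * (c * x - y * z)
    lemma₂ = solve-∀ ℚ-ring
  eq : ∀ j → ∑[ i < suc (suc m) ] (a′ i * v i j) ≡ 0ℚ
  -- Since `v p zero` is `c`, every reduced vector vanishes in coordinate `zero`.
  eq zero    = trans (expand zero) (sum-zero λ k → lemma c (b k) (u k zero))
    where
    lemma : ∀ c b x → b * (c * x - x * c) ≡ 0ℚ
    lemma = solve-∀ ℚ-ring
  eq (suc j) = trans (expand (suc j)) (proj₂ (proj₂ rest) j)

-- Matrices acting on functions

Matrix : ℕ → Set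
Matrix N = Fin N → Vector ℚ N

infixr 7 _·_

_·_ : Matrix N → Vector ℚ N → Vector ℚ N
(W · f) x = ∑[ z < _ ] (W x z * f z)

power : Matrix N → ℕ → Vector ℚ N → Vector ℚ N
power W zero    f = f
power W (suc n) f = W · power W n f

indicator : Dec A → ℚ
indicator (yes _) = 1ℚ
indicator (no _)  = 0ℚ

indicator-yes : (A? : Dec A) → A → indicator A? ≡ 1ℚ
indicator-yes (yes _) _ = refl
indicator-yes (no ¬a) a = contradiction a ¬a

indicator-no : (A? : Dec A) → ¬ A → indicator A? ≡ 0ℚ
indicator-no (yes a) ¬a = contradiction a ¬a
indicator-no (no _)  _  = refl

indicator-cong : (A? : Dec A) (B? : Dec B) → (A → B) → (B → A) →
  indicator A? ≡ indicator B?
indicator-cong (yes a) B? A⇒B B⇒A = sym (indicator-yes B? (A⇒B a))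
indicator-cong (no ¬a) B? A⇒B B⇒A = sym (indicator-no B? (¬a ∘ B⇒A))

-- `basis y` is the unit vector at `y`, so `power W n (basis y) x` is the entry of the `n`-th matrix
-- power in row `x` and column `y`. Read as a matrix, `basis` is the identity.
basis : Fin N → Vector ℚ N
basis y x = indicator (x ≟ y)

basis-sym : ∀ (x y : Fin N) → basis x y ≡ basis y x
basis-sym x y = indicator-cong (y ≟ x) (x ≟ y) sym sym

sum-basis : ∀ (x : Fin N) (f : Vector ℚ N) → ∑[ z < N ] (basis x z * f z) ≡ f x
sum-basis {suc N} x f = begin
  ∑[ z < suc N ] (basis x z * f z)
    ≡⟨ sum-remove {i = x} (λ z → basis x z * f z) ⟩
  basis x x * f x + ∑[ k < N ] (basis x (punchIn x k) * f (punchIn x k))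
    ≡⟨ cong₂ _+_ (cong (_* f x) (indicator-yes (x ≟ x) refl))
         (sum-zero λ k → trans
           (cong (_* f (punchIn x k)) (indicator-no (punchIn x k ≟ x) (punchInᵢ≢i x k)))
           (ℚ.*-zeroˡ (f (punchIn x k)))) ⟩
  1ℚ * f x + 0ℚ
    ≡⟨ trans (ℚ.+-identityʳ _) (ℚ.*-identityˡ (f x)) ⟩
  f x ∎
  where open ≡-Reasoning

·-cong : ∀ (W : Matrix N) {f g} → (∀ x → f x ≡ g x) → ∀ x → (W · f) x ≡ (W · g) x
·-cong W f≗g x = sum-cong-≗ λ z → cong (W x z *_) (f≗g z)

·-sub : ∀ (W : Matrix N) f g x → (W · (λ z → f z - g z)) x ≡ (W · f) x - (W · g) x
·-sub W f g x = trans (sum-cong-≗ λ z → lemma (W x z) (f z) (g z))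
  (sum-sub (λ z → W x z * f z) (λ z → W x z * g z))
  where
  lemma : ∀ w a b → w * (a - b) ≡ w * a - w * b
  lemma = solve-∀ ℚ-ring

power-cong : ∀ (W : Matrix N) n {f g} → (∀ x → f x ≡ g x) → ∀ x → power W n f x ≡ power W n g x
power-cong W zero    f≗g = f≗g
power-cong W (suc n) f≗g = ·-cong W (power-cong W n f≗g)

power-sub : ∀ (W : Matrix N) n f g x →
  power W n (λ z → f z - g z) x ≡ power W n f x - power W n g x
power-sub W zero    f g x = refl
power-sub W (suc n) f g x = trans (·-cong W (power-sub W n f g) x)
  (·-sub W (power W n f) (power W n g) x)

power-suc : ∀ (W : Matrix N) n f x → power W (suc n) f x ≡ power W n (W · f) x
power-suc W zero    f x = refl
power-suc W (suc n) f x = ·-cong W (power-suc W n f) x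

-- Polynomials in a matrix, applied to a vector

polynomial : Matrix N → Vector ℚ m → Vector ℚ N → Vector ℚ N
polynomial W a f x = ∑[ i < _ ] (a i * power W (toℕ i) f x)

-- Horner's rule: one factor `W` is pulled out of all terms of positive degree, by interchanging the
-- two sums.
polynomial-suc : ∀ (W : Matrix N) (a : Vector ℚ (suc m)) f x →
  polynomial W a f x ≡ head a * f x + (W · polynomial W (tail a) f) x
polynomial-suc {N} {m} W a f x = cong (head a * f x +_) (begin
  ∑[ i < m ] (a (suc i) * ∑[ z < N ] (W x z * p i z))
    ≡⟨ sum-cong-≗ (λ i → *-distribˡ-sum (a (suc i)) λ z → W x z * p i z) ⟩
  ∑[ i < m ] ∑[ z < N ] (a (suc i) * (W x z * p i z))
    ≡⟨ ∑-comm (λ i z → a (suc i) * (W x z * p i z)) ⟩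
  ∑[ z < N ] ∑[ i < m ] (a (suc i) * (W x z * p i z))
    ≡⟨ sum-cong-≗ (λ z → sum-cong-≗ λ i → lemma (a (suc i)) (W x z) (p i z)) ⟩
  ∑[ z < N ] ∑[ i < m ] (W x z * (a (suc i) * p i z))
    ≡⟨ sum-cong-≗ (λ z → *-distribˡ-sum (W x z) λ i → a (suc i) * p i z) ⟨
  (W · polynomial W (tail a) f) x ∎)
  where
  open ≡-Reasoning
  p : Fin m → Vector ℚ N
  p i = power W (toℕ i) f
  lemma : ∀ a b c → a * (b * c) ≡ b * (a * c)
  lemma = solve-∀ ℚ-ring

-- The powers of `W` with exponents from 0 to `N * N` are one more in number than the entries of a
-- matrix, hence linearly dependent.
annihilator : ∀ (W : Matrix N) → ∃ λ (a : Vector ℚ (suc (N ℕ.* N))) →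
  (∃ λ i → a i ≢ 0ℚ) × (∀ y x → polynomial W a (basis y) x ≡ 0ℚ)
annihilator {N} W = a , a≢0 , λ y x → trans (sym (entry y x)) (eq (combine y x))
  where
  v : Fin (suc (N ℕ.* N)) → Vector ℚ (N ℕ.* N)
  -- The index `k` encodes first the column and then the row, matching `combine y x` in `entry`.
  v i k = power W (toℕ i) (basis (proj₁ (remQuot {N} N k))) (proj₂ (remQuot {N} N k))
  dep = dependent (N ℕ.* N) v
  a = proj₁ dep
  a≢0 = proj₁ (proj₂ dep)
  eq = proj₂ (proj₂ dep)
  entry : ∀ y x → ∑[ i < suc (N ℕ.* N) ] (a i * v i (combine y x)) ≡ polynomial W a (basis y) x
  entry y x = sum-cong-≗ λ i →
    cong (λ k → a i * power W (toℕ i) (basis (proj₁ k)) (proj₂ k)) (remQuot-combine y x)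

-- Removing the vanishing low-order coefficients of an annihilating polynomial leaves
-- one factor W when W² and W have the same kernel.
annihilator-simple-root : ∀ (W : Matrix N) →
  (∀ f → (∀ x → (W · W · f) x ≡ 0ℚ) → ∀ x → (W · f) x ≡ 0ℚ) →
  (a : Vector ℚ m) → (∃ λ i → a i ≢ 0ℚ) →
  (∀ y x → (W · polynomial W a (basis y)) x ≡ 0ℚ) →
  ∃ λ k → ∃ λ (b : Vector ℚ (suc k)) → head b ≢ 0ℚ ×
    (∀ y x → (W · polynomial W b (basis y)) x ≡ 0ℚ)
annihilator-simple-root {m = suc m} W ker a (i , ai≢0) eq with head a ℚ.≟ 0ℚ
... | no a₀≢0  = m , a , a₀≢0 , eq
... | yes a₀≡0 = annihilator-simple-root W ker (tail a) (tail-nonzero i ai≢0)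
    λ y → ker (polynomial W (tail a) (basis y)) λ x →
      trans (sym (·-cong W (shift (basis y)) x)) (eq y x)
  where
  tail-nonzero : ∀ i → a i ≢ 0ℚ → ∃ λ j → tail a j ≢ 0ℚ
  tail-nonzero zero    a₀≢0 = contradiction a₀≡0 a₀≢0
  tail-nonzero (suc j) aj≢0 = j , aj≢0
  shift : ∀ f x → polynomial W a f x ≡ (W · polynomial W (tail a) f) x
  shift f x = trans (polynomial-suc W a f x)
    (trans (cong (λ c → c * f x + (W · polynomial W (tail a) f) x) a₀≡0)
      (trans (cong (_+ (W · polynomial W (tail a) f) x) (ℚ.*-zeroˡ (f x)))
        (ℚ.+-identityˡ _)))

-- Markov chains

module Laplacian (P : Matrix N) where

  Δ : Matrix N
  Δ x z = basis x z - P x z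

  Δ· : ∀ f x → (Δ · f) x ≡ f x - (P · f) x
  Δ· f x = begin
    (Δ · f) x
      ≡⟨ sum-cong-≗ (λ z → lemma (basis x z) (P x z) (f z)) ⟩
    ∑[ z < N ] (basis x z * f z - P x z * f z)
      ≡⟨ sum-sub (λ z → basis x z * f z) (λ z → P x z * f z) ⟩
    ∑[ z < N ] (basis x z * f z) - (P · f) x
      ≡⟨ cong (_- (P · f) x) (sum-basis x f) ⟩
    f x - (P · f) x ∎
    where
    open ≡-Reasoning
    lemma : ∀ a b c → (a - b) * c ≡ a * c - b * c
    lemma = solve-∀ ℚ-ring

  -- Powers of `Δ` are linear combinations of powers of `P`. To avoid binomial coefficients, the
  -- induction on `k` treats the diagonals of all products `Δ^k P^j` at once, using
  -- `Δ^(k+1) P^j = Δ^k P^j - Δ^k P^(j+1)`.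
  diagonal-constant : (∀ n x y → power P n (basis x) x ≡ power P n (basis y) y) →
    ∀ k x y → power Δ k (basis x) x ≡ power Δ k (basis y) y
  diagonal-constant diag k x y = mixed k 0 x y
    where
    open ≡-Reasoning
    step : ∀ k j x → power Δ (suc k) (power P j (basis x)) x
      ≡ power Δ k (power P j (basis x)) x - power Δ k (power P (suc j) (basis x)) x
    step k j x = begin
      power Δ (suc k) f x                    ≡⟨ power-suc Δ k f x ⟩
      power Δ k (Δ · f) x                    ≡⟨ power-cong Δ k (Δ· f) x ⟩
      power Δ k (λ z → f z - (P · f) z) x    ≡⟨ power-sub Δ k f (P · f) x ⟩
      power Δ k f x - power Δ k (P · f) x    ∎
      where f = power P j (basis x)
    mixed : ∀ k j x y → power Δ k (power P j (basis x)) x ≡ power Δ k (power P j (basis y)) y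
    mixed zero    j x y = diag j x y
    mixed (suc k) j x y = trans (step k j x)
      (trans (cong₂ _-_ (mixed k j x y) (mixed k (suc j) x y)) (sym (step k j y)))

  -- `π` is a stationary row vector, not normalised to total mass 1, so that it can be the degree
  -- vector. `liouville` is later supplied by the maximum principle.
  module _ (π : Vector ℚ N) (∑π≢0 : sum π ≢ 0ℚ)
    (stationary : ∀ y → ∑[ x < N ] (π x * P x y) ≡ π y)
    (liouville : ∀ (f : Vector ℚ N) → (∀ x → (P · f) x ≡ f x) → ∀ x y → f x ≡ f y)
    where

    open ≡-Reasoning

    Δ-kernel-constant : ∀ f → (∀ x → (Δ · f) x ≡ 0ℚ) → ∀ x y → f x ≡ f y
    Δ-kernel-constant f Δf≡0 = liouville f λ x →
      sym (x-y≡0⇒x≡y (trans (sym (Δ· f x)) (Δf≡0 x)))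

    π-Δ-column : ∀ y → ∑[ x < N ] (π x * Δ x y) ≡ 0ℚ
    π-Δ-column y = begin
      ∑[ x < N ] (π x * Δ x y)
        ≡⟨ sum-cong-≗ (λ x → trans (lemma (π x) (basis x y) (P x y))
             (cong (λ b → b * π x - π x * P x y) (basis-sym x y))) ⟩
      ∑[ x < N ] (basis y x * π x - π x * P x y)
        ≡⟨ sum-sub (λ x → basis y x * π x) (λ x → π x * P x y) ⟩
      ∑[ x < N ] (basis y x * π x) - ∑[ x < N ] (π x * P x y)
        ≡⟨ cong₂ _-_ (sum-basis y π) (stationary y) ⟩
      π y - π y
        ≡⟨ ℚ.+-inverseʳ (π y) ⟩
      0ℚ ∎
      where
      lemma : ∀ p b q → p * (b - q) ≡ b * p - p * q
      lemma = solve-∀ ℚ-ring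

    -- Interchanging the sums pairs `π` with the columns of `Δ`, where stationarity gives zero. Thus
    -- `π` annihilates the image of `Δ`.
    π-Δ : ∀ f → ∑[ x < N ] (π x * (Δ · f) x) ≡ 0ℚ
    π-Δ f = begin
      ∑[ x < N ] (π x * (Δ · f) x)
        ≡⟨ sum-cong-≗ (λ x → *-distribˡ-sum (π x) λ z → Δ x z * f z) ⟩
      ∑[ x < N ] ∑[ z < N ] (π x * (Δ x z * f z))
        ≡⟨ ∑-comm (λ x z → π x * (Δ x z * f z)) ⟩
      ∑[ z < N ] ∑[ x < N ] (π x * (Δ x z * f z))
        ≡⟨ sum-cong-≗ (λ z → sum-cong-≗ λ x → sym (ℚ.*-assoc (π x) (Δ x z) (f z))) ⟩
      ∑[ z < N ] ∑[ x < N ] (π x * Δ x z * f z)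
        ≡⟨ sum-cong-≗ (λ z → *-distribʳ-sum (f z) λ x → π x * Δ x z) ⟨
      ∑[ z < N ] (∑[ x < N ] (π x * Δ x z) * f z)
        ≡⟨ sum-zero (λ z → trans (cong (_* f z) (π-Δ-column z)) (ℚ.*-zeroˡ (f z))) ⟩
      0ℚ ∎

    π-constant : ∀ (f : Vector ℚ N) x → (∀ z → f z ≡ f x) → ∑[ z < N ] (π z * f z) ≡ sum π * f x
    π-constant f x const = trans (sum-cong-≗ λ z → cong (π z *_) (const z))
      (sym (*-distribʳ-sum (f x) π))

    -- The function `Δ · f` lies in the kernel of `Δ`, so it is constant. Its pairing with `π` is
    -- that constant times `sum π`, and it vanishes because `π` annihilates the image of `Δ`.
    Δ²-kernel : ∀ f → (∀ x → (Δ · Δ · f) x ≡ 0ℚ) → ∀ x → (Δ · f) x ≡ 0ℚ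
    Δ²-kernel f Δ²f≡0 x = *-cancel-0 ∑π≢0
      (trans (sym (π-constant (Δ · f) x λ z → Δ-kernel-constant (Δ · f) Δ²f≡0 z x)) (π-Δ f))

    stationary-constant : (∀ n x y → power P n (basis x) x ≡ power P n (basis y) y) →
      ∀ x y → π x ≡ π y
    stationary-constant diag x y = *-cancelˡ b₀≢0 (begin
      head b * π x       ≡⟨ mass x ⟨
      sum π * g x x      ≡⟨ cong (sum π *_) (sum-cong-≗ λ i →
                              cong (b i *_) (diagonal-constant diag (toℕ i) x y)) ⟩
      sum π * g y y      ≡⟨ mass y ⟩
      head b * π y       ∎)
      where
      -- `annihilator` gives the relation without a leading `Δ`. The factor is put in front because
      -- only the relation with it survives the removal of low-order coefficients.
      root = let a , a≢0 , a-eq = annihilator Δ in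
        annihilator-simple-root Δ Δ²-kernel a a≢0
          λ y x → sum-zero λ z → trans (cong (Δ x z *_) (a-eq y z)) (ℚ.*-zeroʳ (Δ x z))
      b = proj₁ (proj₂ root)
      b₀≢0 = proj₁ (proj₂ (proj₂ root))
      g : Fin N → Vector ℚ N
      g y = polynomial Δ b (basis y)
      lemma : ∀ p b e h → p * (b * e + h) ≡ b * (e * p) + p * h
      lemma = solve-∀ ℚ-ring
      -- Column `y` of the matrix polynomial is killed by `Δ`, hence constant and equal to its
      -- diagonal entry. In its pairing with `π` only the constant coefficient remains, since every
      -- other term has a factor `Δ` on the left.
      mass : ∀ y → sum π * g y y ≡ head b * π y
      mass y = begin
        sum π * g y y
          ≡⟨ π-constant (g y) y (λ z →
               Δ-kernel-constant (g y) (proj₂ (proj₂ (proj₂ root)) y) z y) ⟨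
        ∑[ z < N ] (π z * g y z)
          ≡⟨ sum-cong-≗ (λ z → trans (cong (π z *_) (polynomial-suc Δ b (basis y) z))
               (lemma (π z) (head b) (basis y z) ((Δ · h) z))) ⟩
        ∑[ z < N ] (head b * (basis y z * π z) + π z * (Δ · h) z)
          ≡⟨ ∑-distrib-+ (λ z → head b * (basis y z * π z)) (λ z → π z * (Δ · h) z) ⟩
        ∑[ z < N ] (head b * (basis y z * π z)) + ∑[ z < N ] (π z * (Δ · h) z)
          ≡⟨ cong₂ _+_ (sym (*-distribˡ-sum (head b) λ z → basis y z * π z)) (π-Δ h) ⟩
        head b * ∑[ z < N ] (basis y z * π z) + 0ℚ
          ≡⟨ trans (ℚ.+-identityʳ _) (cong (head b *_) (sum-basis y π)) ⟩
        head b * π y ∎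
        where h = polynomial Δ (tail b) (basis y)

-- The factor `k` is the `n`-th power of `c`. It stays existential because only its being nonzero
-- and independent of `f` and `x` matters later.
power-scale : ∀ {W W′ : Matrix N} {c} → c ≢ 0ℚ → (∀ x z → W x z ≡ c * W′ x z) →
  ∀ n → ∃ λ k → k ≢ 0ℚ × (∀ f x → power W n f x ≡ k * power W′ n f x)
power-scale c≢0 W≡cW′ zero = 1ℚ , ℚ.1≢0 , λ f x → sym (ℚ.*-identityˡ (f x))
power-scale {N} {W} {W′} {c} c≢0 W≡cW′ (suc n) with power-scale {W = W} {W′} c≢0 W≡cW′ n
... | k , k≢0 , eq = c * k , k≢0 ∘ *-cancel-0 c≢0 , λ f x → trans
  (sum-cong-≗ λ z → trans (cong₂ _*_ (W≡cW′ x z) (eq f z))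
    (lemma c (W′ x z) k (power W′ n f z)))
  (sym (*-distribˡ-sum (c * k) λ z → W′ x z * power W′ n f z))
  where
  lemma : ∀ c w k p → (c * w) * (k * p) ≡ (c * k) * (w * p)
  lemma = solve-∀ ℚ-ring

-- Maximum principle

maximum : ∀ (f : Vector ℚ N) → Fin N → ∃ λ m → ∀ z → f z ≤ f m
maximum {N} f x = argmax f x (allFin N) , λ z →
  All.lookup (f[xs]≤f[argmax] {f = f} x (allFin N)) (∈-allFin z)
  where open Data.List.Extrema (DecTotalOrder.totalOrder ℚ.≤-decTotalOrder)

-- Where `f` attains its maximum, harmonicity makes the weighted defects `P u z * (f top - f z)` sum
-- to zero. They are nonnegative, so each vanishes, and `f` is maximal at every `z` with `u ~ z`
-- too. Paths carry this from `top` to every vertex.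
harmonic-constant : ∀ {P : Matrix N} {_~_ : Fin N → Fin N → Set} →
  (∀ x → sum (P x) ≡ 1ℚ) → (∀ x z → 0ℚ ≤ P x z) → (∀ {x z} → x ~ z → P x z ≢ 0ℚ) →
  (∀ x y → Star _~_ x y) →
  ∀ f → (∀ x → (P · f) x ≡ f x) → ∀ x y → f x ≡ f y
harmonic-constant {N} {P} {_~_} stochastic P≥0 P≢0 connected f Pf≡f x y =
  trans (≡max refl (connected top x)) (sym (≡max refl (connected top y)))
  where
  open ≡-Reasoning
  top = proj₁ (maximum f x)
  f≤ftop = proj₂ (maximum f x)

  defect : Fin N → Vector ℚ N
  defect u z = P u z * (f top - f z)

  defect≥0 : ∀ u z → 0ℚ ≤ defect u z
  defect≥0 u z = ℚ.nonNegative⁻¹ _ {{ℚ.nonNeg*nonNeg⇒nonNeg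
    (P u z) {{nonNegative (P≥0 u z)}}
    (f top - f z) {{nonNegative (subst (_≤ f top - f z) (ℚ.+-inverseʳ (f z)) (ℚ.+-monoˡ-≤ (- f z) (f≤ftop z)))}}}}

  sum-defect : ∀ {u} → f u ≡ f top → sum (defect u) ≡ 0ℚ
  sum-defect {u} fu≡ftop = begin
    sum (defect u)
      ≡⟨ sum-cong-≗ (λ z → lemma (P u z) (f top) (f z)) ⟩
    ∑[ z < N ] (P u z * f top - P u z * f z)
      ≡⟨ sum-sub (λ z → P u z * f top) (λ z → P u z * f z) ⟩
    ∑[ z < N ] (P u z * f top) - (P · f) u
      ≡⟨ cong₂ _-_ (sym (*-distribʳ-sum (f top) (P u))) (trans (Pf≡f u) fu≡ftop) ⟩
    sum (P u) * f top - f top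
      ≡⟨ cong (λ s → s * f top - f top) (stochastic u) ⟩
    1ℚ * f top - f top
      ≡⟨ cong (_- f top) (ℚ.*-identityˡ (f top)) ⟩
    f top - f top
      ≡⟨ ℚ.+-inverseʳ (f top) ⟩
    0ℚ ∎
    where
    lemma : ∀ p a b → p * (a - b) ≡ p * a - p * b
    lemma = solve-∀ ℚ-ring

  ≡max : ∀ {u v} → f u ≡ f top → Star _~_ u v → f v ≡ f top
  ≡max fu≡ftop ε = fu≡ftop
  ≡max {u} fu≡ftop (_◅_ {j = z} u~z z⟶v) = ≡max
    (sym (x-y≡0⇒x≡y (*-cancel-0 (P≢0 u~z)
      (sum-nonNeg-≡0 (defect≥0 u) (sum-defect fu≡ftop) z))))
    z⟶v

-- Sums over lists

sumℚ-cong : ∀ {f g : A → ℚ} → (∀ a → f a ≡ g a) → ∀ xs →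
  sumℚ (List.map f xs) ≡ sumℚ (List.map g xs)
sumℚ-cong f≗g []       = refl
sumℚ-cong f≗g (x ∷ xs) = cong₂ _+_ (f≗g x) (sumℚ-cong f≗g xs)

sumℚ-++ : ∀ xs ys → sumℚ (xs List.++ ys) ≡ sumℚ xs + sumℚ ys
sumℚ-++ []       ys = sym (ℚ.+-identityˡ _)
sumℚ-++ (x ∷ xs) ys = trans (cong (x +_) (sumℚ-++ xs ys)) (sym (ℚ.+-assoc x _ _))

*-distribˡ-sumℚ : ∀ c (f : A → ℚ) xs →
  c * sumℚ (List.map f xs) ≡ sumℚ (List.map (λ a → c * f a) xs)
*-distribˡ-sumℚ c f []       = ℚ.*-zeroʳ c
*-distribˡ-sumℚ c f (x ∷ xs) = trans (ℚ.*-distribˡ-+ c (f x) _)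
  (cong (c * f x +_) (*-distribˡ-sumℚ c f xs))

sumℚ-tabulate : ∀ (f : Vector ℚ N) → sumℚ (List.tabulate f) ≡ sum f
sumℚ-tabulate {zero}  f = refl
sumℚ-tabulate {suc N} f = cong (f zero +_) (sumℚ-tabulate (f ∘ suc))

sumℚ-allFin : ∀ (f : Vector ℚ N) → sumℚ (List.map f (allFin N)) ≡ sum f
sumℚ-allFin f = trans (cong sumℚ (map-tabulate id f)) (sumℚ-tabulate f)

sumℚ-cartesianProductWith : ∀ {C : Set} (F : C → ℚ) (_⊗_ : A → B → C) xs ys →
  sumℚ (List.map F (List.cartesianProductWith _⊗_ xs ys))
    ≡ sumℚ (List.map (λ x → sumℚ (List.map (λ y → F (x ⊗ y)) ys)) xs)
sumℚ-cartesianProductWith F _⊗_ []       ys = refl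
sumℚ-cartesianProductWith F _⊗_ (x ∷ xs) ys = begin
  sumℚ (List.map F (List.map (x ⊗_) ys List.++ rest))
    ≡⟨ cong sumℚ (map-++ F (List.map (x ⊗_) ys) rest) ⟩
  sumℚ (List.map F (List.map (x ⊗_) ys) List.++ List.map F rest)
    ≡⟨ sumℚ-++ (List.map F (List.map (x ⊗_) ys)) (List.map F rest) ⟩
  sumℚ (List.map F (List.map (x ⊗_) ys)) + sumℚ (List.map F rest)
    ≡⟨ cong₂ _+_ (cong sumℚ (sym (map-∘ ys))) (sumℚ-cartesianProductWith F _⊗_ xs ys) ⟩
  sumℚ (List.map (λ y → F (x ⊗ y)) ys)
    + sumℚ (List.map (λ x → sumℚ (List.map (λ y → F (x ⊗ y)) ys)) xs) ∎
  where
  open ≡-Reasoning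
  rest = List.cartesianProductWith _⊗_ xs ys

sumℚ-filter : ∀ {P : U.Pred A _} (P? : U.Decidable P) (f : A → ℚ) xs →
  sumℚ (List.map f (filter P? xs)) ≡ sumℚ (List.map (λ a → indicator (P? a) * f a) xs)
sumℚ-filter P? f []       = refl
sumℚ-filter P? f (x ∷ xs) with P? x
... | yes _ = cong₂ _+_ (sym (ℚ.*-identityˡ (f x))) (sumℚ-filter P? f xs)
... | no  _ = trans (sumℚ-filter P? f xs)
  (trans (sym (ℚ.+-identityˡ _)) (cong (_+ _) (sym (ℚ.*-zeroˡ (f x)))))

indicator-× : (A? : Dec A) (B? : Dec B) → indicator (A? ×-dec B?) ≡ indicator A? * indicator B?
indicator-× (yes a) B? = trans (indicator-cong (yes a ×-dec B?) B? proj₂ (a ,_))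
  (sym (ℚ.*-identityˡ (indicator B?)))
indicator-× (no ¬a) B? = trans (indicator-no (no ¬a ×-dec B?) (¬a ∘ proj₁))
  (sym (ℚ.*-zeroˡ (indicator B?)))

indicator-idem : (A? : Dec A) → indicator A? * indicator A? ≡ indicator A?
indicator-idem (yes _) = refl
indicator-idem (no _)  = refl

-- Natural numbers as rationals.

fromℕ : ℕ → ℚ
fromℕ n = ℤ.+ n / 1

-- The fraction `n / 1` passes through gcd normalisation and does not compute for variable `n`, so
-- the equation is checked on unnormalised fractions.
fromℕ-suc : ∀ n → fromℕ (suc n) ≡ 1ℚ + fromℕ n
fromℕ-suc n = ℚ.toℚᵘ-injective (begin
  toℚᵘ (fromℕ (suc n))           ≈⟨ ℚ.toℚᵘ-fromℚᵘ (mkℚᵘ (ℤ.+ suc n) 0) ⟩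
  mkℚᵘ (ℤ.+ suc n) 0               ≈⟨ *≡* (cong (λ k → (ℤ.+ 1 ℤ.+ k) ℤ.* ℤ.+ 1) (sym (ℤ.*-identityʳ (ℤ.+ n)))) ⟩
  ℚᵘ.1ℚᵘ ℚᵘ.+ mkℚᵘ (ℤ.+ n) 0       ≈⟨ ℚᵘ.+-congʳ ℚᵘ.1ℚᵘ (ℚ.toℚᵘ-fromℚᵘ (mkℚᵘ (ℤ.+ n) 0)) ⟨
  ℚᵘ.1ℚᵘ ℚᵘ.+ toℚᵘ (fromℕ n)     ≈⟨ ℚ.toℚᵘ-homo-+ 1ℚ (fromℕ n) ⟨
  toℚᵘ (1ℚ + fromℕ n)            ∎)
  where open ℚᵘ.≃-Reasoning

fromℕ-injective : ∀ {m n} → fromℕ m ≡ fromℕ n → m ≡ n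
fromℕ-injective {m} {n} eq with ℚ./-injective-≃ (mkℚᵘ (ℤ.+ m) 0) (mkℚᵘ (ℤ.+ n) 0) eq
... | *≡* eq′ = ℤ.+-injective (trans (sym (ℤ.*-identityʳ (ℤ.+ m))) (trans eq′ (ℤ.*-identityʳ (ℤ.+ n))))

fromℕ-nonNeg : ∀ n → 0ℚ ≤ fromℕ n
fromℕ-nonNeg n = ℚ.nonNegative⁻¹ (fromℕ n) {{ℚ.normalize-nonNeg n 1}}

reciprocal : ∀ n .{{_ : ℕ.NonZero n}} → 1ℤ / n * fromℕ n ≡ 1ℚ
reciprocal n@(suc n-1) = ℚ.toℚᵘ-injective (begin
  toℚᵘ (1ℤ / n * fromℕ n)              ≈⟨ ℚ.toℚᵘ-homo-* (1ℤ / n) (fromℕ n) ⟩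
  toℚᵘ (1ℤ / n) ℚᵘ.* toℚᵘ (fromℕ n)    ≈⟨ ℚᵘ.*-cong (ℚ.toℚᵘ-fromℚᵘ (mkℚᵘ 1ℤ n-1)) (ℚ.toℚᵘ-fromℚᵘ (mkℚᵘ (ℤ.+ n) 0)) ⟩
  mkℚᵘ 1ℤ n-1 ℚᵘ.* mkℚᵘ (ℤ.+ n) 0        ≈⟨ *≡* (ℤ.*-assoc 1ℤ (ℤ.+ n) 1ℤ) ⟩
  ℚᵘ.1ℚᵘ                               ∎)
  where open ℚᵘ.≃-Reasoning

length-filter : ∀ {P : U.Pred A _} (P? : U.Decidable P) xs →
  fromℕ (List.length (filter P? xs)) ≡ sumℚ (List.map (λ a → indicator (P? a)) xs)
length-filter P? []       = refl
length-filter P? (x ∷ xs) with P? x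
... | yes _ = trans (fromℕ-suc (List.length (filter P? xs))) (cong (1ℚ +_) (length-filter P? xs))
... | no  _ = trans (length-filter P? xs) (sym (ℚ.+-identityˡ _))

-- Walks and matrix powers

-- One notion for both sides: with the adjacency matrix this is the indicator of being a walk, with
-- the transition matrix the probability of a trajectory given its start.
weight : Matrix N → Vec (Fin N) (suc n) → ℚ
weight W (x ∷ [])     = 1ℚ
weight W (x ∷ y ∷ ys) = W x y * weight W (y ∷ ys)

sum-sequences : ∀ (F : Vec (Fin N) (suc n) → ℚ) →
  sumℚ (List.map F (sequences N (suc n)))
    ≡ ∑[ x < N ] sumℚ (List.map (λ xs → F (x ∷ xs)) (sequences N n))
sum-sequences {N} {n} F = trans
  (sumℚ-cartesianProductWith F _∷_ (allFin N) (sequences N n))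
  (sumℚ-allFin λ x → sumℚ (List.map (λ xs → F (x ∷ xs)) (sequences N n)))

-- Expanding a matrix power into a sum over paths, by peeling off the first step. The start `x` is
-- kept apart, so `n` steps correspond to sequences of length `n`.
sum-weights-from : ∀ (W : Matrix N) n f x →
  sumℚ (List.map (λ xs → weight W (x ∷ xs) * f (Vec.last (x ∷ xs))) (sequences N n))
    ≡ power W n f x
sum-weights-from W zero f x = trans (ℚ.+-identityʳ _) (ℚ.*-identityˡ (f x))
sum-weights-from {N} W (suc n) f x = trans
  (sum-sequences λ xs → weight W (x ∷ xs) * f (Vec.last (x ∷ xs)))
  (sum-cong-≗ λ z → begin
    sumℚ (List.map (λ xs → W x z * weight W (z ∷ xs) * f (Vec.last (z ∷ xs))) (sequences N n))
      ≡⟨ sumℚ-cong (λ xs → ℚ.*-assoc (W x z) _ _) (sequences N n) ⟩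
    sumℚ (List.map (λ xs → W x z * (weight W (z ∷ xs) * f (Vec.last (z ∷ xs)))) (sequences N n))
      ≡⟨ *-distribˡ-sumℚ (W x z) _ (sequences N n) ⟨
    W x z * sumℚ (List.map (λ xs → weight W (z ∷ xs) * f (Vec.last (z ∷ xs))) (sequences N n))
      ≡⟨ cong (W x z *_) (sum-weights-from W n f z) ⟩
    W x z * power W n f z ∎)
  where open ≡-Reasoning

-- The same sum over sequences that include the start, which `basis x` pins to `x`. Closed-walk
-- counts and return probabilities both take this form with `f = basis x`.
sum-weights : ∀ (W : Matrix N) n f x →
  sumℚ (List.map (λ v → basis x (Vec.head v) * (weight W v * f (Vec.last v))) (sequences N (suc n)))
    ≡ power W n f x
sum-weights {N} W n f x = begin
  sumℚ (List.map (λ v → basis x (Vec.head v) * (weight W v * f (Vec.last v))) (sequences N (suc n)))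
    ≡⟨ sum-sequences {n = n} (λ v → basis x (Vec.head v) * (weight W v * f (Vec.last v))) ⟩
  ∑[ z < N ] sumℚ (List.map (λ xs → basis x z * (weight W (z ∷ xs) * f (Vec.last (z ∷ xs)))) (sequences N n))
    ≡⟨ sum-cong-≗ (λ z → *-distribˡ-sumℚ (basis x z) _ (sequences N n)) ⟨
  ∑[ z < N ] (basis x z * sumℚ (List.map (λ xs → weight W (z ∷ xs) * f (Vec.last (z ∷ xs))) (sequences N n)))
    ≡⟨ sum-basis x (λ z → sumℚ (List.map (λ xs → weight W (z ∷ xs) * f (Vec.last (z ∷ xs))) (sequences N n))) ⟩
  sumℚ (List.map (λ xs → weight W (x ∷ xs) * f (Vec.last (x ∷ xs))) (sequences N n))
    ≡⟨ sum-weights-from W n f x ⟩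
  power W n f x ∎
  where open ≡-Reasoning

-- Simple random walk

module _ (G : FiniteSimpleGraph) where
  open FiniteSimpleGraph G hiding (V)
  open ≡-Reasoning

  adjacency : Matrix order
  adjacency x y = indicator (adj? x y)

  transition : Matrix order
  transition = transitionProb G

  degreeℚ : Vector ℚ order
  degreeℚ x = fromℕ (degree G x)

  adjacency-sym : ∀ x y → adjacency x y ≡ adjacency y x
  adjacency-sym x y = indicator-cong (adj? x y) (adj? y x) adj-sym adj-sym

  sum-adjacency : ∀ x → sum (adjacency x) ≡ degreeℚ x
  sum-adjacency x = trans (sym (sumℚ-allFin (adjacency x)))
    (sym (length-filter (adj? x) (allFin order)))

  weight-adjacency : (v : Vec (Fin order) (suc n)) →
    weight adjacency v ≡ indicator (linked? adj? v)
  weight-adjacency (x ∷ [])     = refl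
  weight-adjacency (x ∷ y ∷ ys) = begin
    adjacency x y * weight adjacency (y ∷ ys)
      ≡⟨ cong (adjacency x y *_) (weight-adjacency (y ∷ ys)) ⟩
    adjacency x y * indicator (linked? adj? (y ∷ ys))
      ≡⟨ indicator-× (adj? x y) (linked? adj? (y ∷ ys)) ⟨
    indicator (adj? x y ×-dec linked? adj? (y ∷ ys))
      ≡⟨ indicator-cong (adj? x y ×-dec linked? adj? (y ∷ ys)) (linked? adj? (x ∷ y ∷ ys))
           (uncurry _∷_) (λ p → Linked.head p , Linked.tail p) ⟩
    indicator (linked? adj? (x ∷ y ∷ ys)) ∎

  weight-transition : (v : Vec (Fin order) (suc n)) →
    weight transition v ≡ transitionProduct G v
  weight-transition (x ∷ [])     = refl
  weight-transition (x ∷ y ∷ ys) = cong (transition x y *_) (weight-transition (y ∷ ys))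

  #closedWalks-power : ∀ n x → fromℕ (#closedWalks G n x) ≡ power adjacency n (basis x) x
  #closedWalks-power n x = begin
    fromℕ (#closedWalks G n x)
      ≡⟨ length-filter (isClosedWalkAt? G x) (sequences order (suc n)) ⟩
    sumℚ (List.map (λ v → indicator (isClosedWalkAt? G x v)) (sequences order (suc n)))
      ≡⟨ sumℚ-cong closed (sequences order (suc n)) ⟩
    sumℚ (List.map (λ v → basis x (Vec.head v) * (weight adjacency v * basis x (Vec.last v)))
      (sequences order (suc n)))
      ≡⟨ sum-weights adjacency n (basis x) x ⟩
    power adjacency n (basis x) x ∎
    where
    lemma : ∀ a b c → a * (b * c) ≡ b * (a * c)
    lemma = solve-∀ ℚ-ring
    closed : ∀ v → indicator (isClosedWalkAt? G x v)
      ≡ basis x (Vec.head v) * (weight adjacency v * basis x (Vec.last v))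
    closed v = begin
      indicator (isClosedWalkAt? G x v)
        ≡⟨ indicator-× (linked? adj? v) ((Vec.head v ≟ x) ×-dec (Vec.last v ≟ x)) ⟩
      indicator (linked? adj? v) * indicator ((Vec.head v ≟ x) ×-dec (Vec.last v ≟ x))
        ≡⟨ cong₂ _*_ (sym (weight-adjacency v)) (indicator-× (Vec.head v ≟ x) (Vec.last v ≟ x)) ⟩
      weight adjacency v * (basis x (Vec.head v) * basis x (Vec.last v))
        ≡⟨ lemma (weight adjacency v) (basis x (Vec.head v)) (basis x (Vec.last v)) ⟩
      basis x (Vec.head v) * (weight adjacency v * basis x (Vec.last v)) ∎

  trajectoryProb-weight : ∀ x (v : Vec (Fin order) (suc n)) →
    trajectoryProb G x v ≡ basis x (Vec.head v) * weight transition v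
  trajectoryProb-weight x v with Vec.head v ≟ x
  ... | yes _ = trans (sym (weight-transition v)) (sym (ℚ.*-identityˡ (weight transition v)))
  ... | no  _ = sym (ℚ.*-zeroˡ (weight transition v))

  returnProb-power : ∀ n x → returnProb G n x ≡ power transition n (basis x) x
  returnProb-power n x = begin
    returnProb G n x
      ≡⟨ sumℚ-filter (λ v → Vec.last v ≟ x) (trajectoryProb G x) (sequences order (suc n)) ⟩
    sumℚ (List.map (λ v → basis x (Vec.last v) * trajectoryProb G x v) (sequences order (suc n)))
      ≡⟨ sumℚ-cong (λ v → trans
           (cong (basis x (Vec.last v) *_) (trajectoryProb-weight x v))
           (lemma (basis x (Vec.last v)) (basis x (Vec.head v)) (weight transition v)))
           (sequences order (suc n)) ⟩
    sumℚ (List.map (λ v → basis x (Vec.head v) * (weight transition v * basis x (Vec.last v)))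
      (sequences order (suc n)))
      ≡⟨ sum-weights transition n (basis x) x ⟩
    power transition n (basis x) x ∎
    where
    lemma : ∀ a b c → a * (b * c) ≡ b * (c * a)
    lemma = solve-∀ ℚ-ring

  -- A closed walk of length 2 at `x` goes to a neighbour and back, so these walks are counted by
  -- the degree. In matrix terms, adjacency entries are symmetric and idempotent.
  walkRegular⇒degree-constant : WalkRegular G → ∀ x y → degreeℚ x ≡ degreeℚ y
  walkRegular⇒degree-constant regular x y =
    trans (two-steps x) (trans (cong fromℕ (regular 2 x y)) (sym (two-steps y)))
    where
    column : ∀ x z → (adjacency · basis x) z ≡ adjacency x z
    column x z = begin
      (adjacency · basis x) z
        ≡⟨ sum-cong-≗ (λ w → ℚ.*-comm (adjacency z w) (basis x w)) ⟩
      ∑[ w < order ] (basis x w * adjacency z w)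
        ≡⟨ sum-basis x (adjacency z) ⟩
      adjacency z x
        ≡⟨ adjacency-sym z x ⟩
      adjacency x z ∎
    two-steps : ∀ x → degreeℚ x ≡ fromℕ (#closedWalks G 2 x)
    two-steps x = begin
      degreeℚ x
        ≡⟨ sum-adjacency x ⟨
      sum (adjacency x)
        ≡⟨ sum-cong-≗ (λ z → trans (cong (adjacency x z *_) (column x z)) (indicator-idem (adj? x z))) ⟨
      power adjacency 2 (basis x) x
        ≡⟨ #closedWalks-power 2 x ⟨
      fromℕ (#closedWalks G 2 x) ∎

  -- The first step of a path from `x` to the endpoint `u` of the given edge leads to a neighbour;
  -- if the path is empty, `x` is `u` and `v` serves.
  has-neighbour : Connected G → HasEdge G → ∀ x → ∃ (Adj x)
  has-neighbour connected (u , v , u~v) x with connected x u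
  ... | ε       = v , u~v
  ... | x~z ◅ _ = _ , x~z

  -- The transition matrix when every vertex has a neighbour.

  module _ (neighbour : ∀ x → ∃ (Adj x)) where

    inverse-degree : Vector ℚ order
    inverse-degree x = (1ℤ / degree G x) {{degree-nonZero G (proj₂ (neighbour x))}}

    inverse-degree-* : ∀ x → inverse-degree x * degreeℚ x ≡ 1ℚ
    inverse-degree-* x = reciprocal (degree G x) {{degree-nonZero G (proj₂ (neighbour x))}}

    inverse-degree-nonNeg : ∀ x → 0ℚ ≤ inverse-degree x
    inverse-degree-nonNeg x = ℚ.nonNegative⁻¹ (inverse-degree x)
      {{ℚ.normalize-nonNeg 1 (degree G x) {{degree-nonZero G (proj₂ (neighbour x))}}}}

    degreeℚ≢0 : ∀ x → degreeℚ x ≢ 0ℚ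
    degreeℚ≢0 x d≡0 = ℚ.1≢0 (trans (sym (inverse-degree-* x))
      (trans (cong (inverse-degree x *_) d≡0) (ℚ.*-zeroʳ (inverse-degree x))))

    transition-adjacency : ∀ x y → transition x y ≡ inverse-degree x * adjacency x y
    transition-adjacency x y with adj? x y
    -- The two reciprocals carry different proofs that the degree is nonzero, but division takes
    -- that proof irrelevantly.
    ... | yes _ = sym (ℚ.*-identityʳ (inverse-degree x))
    ... | no  _ = sym (ℚ.*-zeroʳ (inverse-degree x))

    adjacency-transition : ∀ x y → adjacency x y ≡ degreeℚ x * transition x y
    adjacency-transition x y = begin
      adjacency x y
        ≡⟨ ℚ.*-identityˡ (adjacency x y) ⟨
      1ℚ * adjacency x y
        ≡⟨ cong (_* adjacency x y) (trans (ℚ.*-comm (degreeℚ x) _) (inverse-degree-* x)) ⟨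
      degreeℚ x * inverse-degree x * adjacency x y
        ≡⟨ ℚ.*-assoc (degreeℚ x) (inverse-degree x) (adjacency x y) ⟩
      degreeℚ x * (inverse-degree x * adjacency x y)
        ≡⟨ cong (degreeℚ x *_) (transition-adjacency x y) ⟨
      degreeℚ x * transition x y ∎

    transition-stochastic : ∀ x → sum (transition x) ≡ 1ℚ
    transition-stochastic x = begin
      sum (transition x)
        ≡⟨ sum-cong-≗ (transition-adjacency x) ⟩
      ∑[ y < order ] (inverse-degree x * adjacency x y)
        ≡⟨ *-distribˡ-sum (inverse-degree x) (adjacency x) ⟨
      inverse-degree x * sum (adjacency x)
        ≡⟨ cong (inverse-degree x *_) (sum-adjacency x) ⟩
      inverse-degree x * degreeℚ x
        ≡⟨ inverse-degree-* x ⟩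
      1ℚ ∎

    transition-nonNeg : ∀ x y → 0ℚ ≤ transition x y
    transition-nonNeg x y with adj? x y
    ... | yes _ = inverse-degree-nonNeg x
    ... | no  _ = ℚ.≤-refl

    transition-Adj : ∀ {x y} → Adj x y → transition x y ≢ 0ℚ
    transition-Adj {x} {y} x~y p≡0 = ℚ.1≢0 (begin
      1ℚ                         ≡⟨ indicator-yes (adj? x y) x~y ⟨
      adjacency x y              ≡⟨ adjacency-transition x y ⟩
      degreeℚ x * transition x y ≡⟨ cong (degreeℚ x *_) p≡0 ⟩
      degreeℚ x * 0ℚ             ≡⟨ ℚ.*-zeroʳ (degreeℚ x) ⟩
      0ℚ                         ∎)

    -- Detailed balance: `degreeℚ x * transition x y` is the adjacency entry, which is symmetric, so
    -- the column sum is a row sum of the adjacency matrix.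
    degree-stationary : ∀ y → ∑[ x < order ] (degreeℚ x * transition x y) ≡ degreeℚ y
    degree-stationary y = begin
      ∑[ x < order ] (degreeℚ x * transition x y)
        ≡⟨ sum-cong-≗ (λ x → trans (sym (adjacency-transition x y)) (adjacency-sym x y)) ⟩
      sum (adjacency y)
        ≡⟨ sum-adjacency y ⟩
      degreeℚ y ∎

    returnProb-constant⇒degree-constant : Connected G →
      (∀ n x y → returnProb G n x ≡ returnProb G n y) → ∀ x y → degreeℚ x ≡ degreeℚ y
    returnProb-constant⇒degree-constant connected return x =
      Laplacian.stationary-constant transition degreeℚ
        -- If the degrees summed to zero, each of them would vanish, including the one at `x`.
        (λ ∑≡0 → degreeℚ≢0 x (sum-nonNeg-≡0 (fromℕ-nonNeg ∘ degree G) ∑≡0 x))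
        degree-stationary
        (harmonic-constant transition-stochastic transition-nonNeg transition-Adj connected)
        (λ n x y → trans (sym (returnProb-power n x)) (trans (return n x y) (returnProb-power n y)))
        x

    -- With all degrees equal to that of `x₀`, the adjacency matrix is a scalar multiple of the
    -- transition matrix, so for each `n` one factor serves all vertices.
    #closedWalks-returnProb : (∀ x y → degreeℚ x ≡ degreeℚ y) → Fin order →
      ∀ n → ∃ λ k → k ≢ 0ℚ × (∀ x → fromℕ (#closedWalks G n x) ≡ k * returnProb G n x)
    #closedWalks-returnProb regular x₀ n =
      let k , k≢0 , eq = power-scale {W = adjacency} {transition} (degreeℚ≢0 x₀)
            (λ x y → trans (adjacency-transition x y) (cong (_* transition x y) (regular x x₀))) n
      in k , k≢0 , λ x → trans (#closedWalks-power n x)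
           (trans (eq (basis x) x) (cong (k *_) (sym (returnProb-power n x))))

mainTheorem1 : (G : FiniteSimpleGraph) → Connected G → HasEdge G →
    WalkRegular G ⇔ ((n : ℕ) (x y : V G) → returnProb G n x ≡ returnProb G n y)
mainTheorem1 G connected edge@(x₀ , _) = mk⇔
  -- Once the degrees agree, counts and probabilities differ by a common nonzero factor, which
  -- cancels.
  (λ regular n x y →
    let k , k≢0 , eq = scale (walkRegular⇒degree-constant G regular) n
    in *-cancelˡ k≢0 (trans (sym (eq x)) (trans (cong fromℕ (regular n x y)) (eq y))))
  -- Here the equality of degrees comes from the Laplacian argument, and the equality of counts is
  -- read off in the rationals.
  (λ return n x y →
    let k , _ , eq = scale (returnProb-constant⇒degree-constant G neighbour connected return) n
    in fromℕ-injective (trans (eq x) (trans (cong (k *_) (return n x y)) (sym (eq y)))))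
  where
  neighbour = has-neighbour G connected edge
  scale : (∀ x y → degreeℚ G x ≡ degreeℚ G y) →
    ∀ n → ∃ λ k → k ≢ 0ℚ × (∀ x → fromℕ (#closedWalks G n x) ≡ k * returnProb G n x)
  scale regular = #closedWalks-returnProb G neighbour regular x₀
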